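{- Let $m\geq 1$ and $n>1$ be integers and let $G$ be an $r$-regular graph of order $m$. If $n\equiv 0\pmod 2$, or $mn\equiv 1\pmod 2$, or $G$ is distance magic, then $G\circ nK_1$ is distance magic.
   Context: A graph $G$ on $v$ vertices is distance magic if there is a bijection $f:V(G)\to\{1,\ldots,v\}$ and a constant $k$ such that for every vertex $x$, $\sum_{y\in N(x)}f(y)=k$, where $N(x)$ is the set of neighbours of $x$. $nK_1$ is the edgeless graph on $n$ vertices. The lexicographic product $G\circ H$ has vertex set $V(G)\times V(H)$, with $(g,h)$ adjacent to $(g',h')$ iff either $gg'\in E(G)$, or $g=g'$ and $hh'\in E(H)$. -}

module Defs where

open import Data.Empty using (⊥)
open import Data.Fin.Base using (Fin; toℕ)
open import Data.Fin.Properties using (*↔×; inj⇒≟)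
open import Data.List.Base using (List; allFin; filter; length; map)
open import Data.Nat.Base using (ℕ; suc; _*_)
open import Data.Nat.ListAction using (sum)
open import Data.Product.Base using (Σ-syntax; ∃-syntax; _×_; _,_)
open import Data.Product.Function.NonDependent.Propositional using (_×-↔_)
open import Data.Sum.Base using (_⊎_; inj₁; inj₂)
open import Function.Bundles using (_↔_; _⤖_; module Inverse; module Bijection)
open import Function.Construct.Composition using (_↔-∘_)
open import Function.Construct.Identity using (↔-id)
open import Function.Construct.Symmetry using (↔-sym)
open import Function.Properties.Inverse using (↔⇒↣)
open import Relation.Binary.Definitions using (Decidable; DecidableEquality; Symmetric)
open import Relation.Binary.PropositionalEquality using (_≡_; sym)
open import Relation.Nullary.Decidable using (no; _×-dec_; _⊎-dec_)
open import Relation.Nullary.Negation using (¬_)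

-- Finite simple graphs of order v. The enumeration only witnesses that V has
-- exactly v elements; `Regular` and `DistanceMagic` do not depend on its choice.
record Graph (v : ℕ) : Set₁ where
  field
    V           : Set
    enumeration : V ↔ Fin v
    Adj         : V → V → Set
    adj?        : Decidable Adj
    adj-sym     : Symmetric Adj
    adj-irrefl  : ∀ {x} → ¬ Adj x x

  infix 4 _≟V_
  _≟V_ : DecidableEquality V
  _≟V_ = inj⇒≟ (↔⇒↣ enumeration)

  vertices : List V
  vertices = map (Inverse.from enumeration) (allFin v)

  -- N(x), each neighbour listed exactly once.
  neighbours : V → List V
  neighbours x = filter (adj? x) vertices

Regular : ∀ {v} → ℕ → Graph v → Set
Regular r G = ∀ x → length (neighbours x) ≡ r
  where open Graph G

-- The label set {1,…,v} is represented by Fin v, with i standing for suc (toℕ i).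
DistanceMagic : ∀ {v} → Graph v → Set
DistanceMagic {v} G =
  Σ[ f ∈ V ⤖ Fin v ] ∃[ k ] (∀ x →
    sum (map (λ y → suc (toℕ (Bijection.to f y))) (neighbours x)) ≡ k)
  where open Graph G

infix 8 _K₁
_K₁ : (n : ℕ) → Graph n
n K₁ = record
  { V           = Fin n
  ; enumeration = ↔-id (Fin n)
  ; Adj         = λ _ _ → ⊥
  ; adj?        = λ _ _ → no λ ()
  ; adj-sym     = λ ()
  ; adj-irrefl  = λ ()
  }

infixr 7 _∘ₗ_
_∘ₗ_ : ∀ {m n} → Graph m → Graph n → Graph (m * n)
_∘ₗ_ {m} {n} G H = record
  { V           = G.V × H.V
  ; enumeration = ↔-sym (*↔× {m} {n}) ↔-∘ (G.enumeration ×-↔ H.enumeration)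
  ; Adj         = λ { (g , h) (g′ , h′) → G.Adj g g′ ⊎ (g ≡ g′ × H.Adj h h′) }
  ; adj?        = λ { (g , h) (g′ , h′) →
                      G.adj? g g′ ⊎-dec ((g G.≟V g′) ×-dec H.adj? h h′) }
  ; adj-sym     = λ { (inj₁ a)       → inj₁ (G.adj-sym a)
                    ; (inj₂ (e , b)) → inj₂ (sym e , H.adj-sym b) }
  ; adj-irrefl  = λ { (inj₁ a)       → G.adj-irrefl a
                    ; (inj₂ (_ , b)) → H.adj-irrefl b }
  }
  where
    module G = Graph G
    module H = Graph H

{-# OPTIONS --safe #-}

-- Write the labelling of G ∘ nK₁ as an n-row table whose columns are the
-- vertices of G, and let row j be an arrangement of the labels jm+1, …, jm+m.
-- A vertex (g , h) sees exactly the full columns of the neighbours of g, so only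
-- the column sums matter, and they may be computed modulo the row offsets jm.
-- A row followed by its reversal contributes a constant to every column. Thus n/2
-- such pairs settle even n; for odd n and distance magic G one extra row carrying
-- the given labelling suffices; for odd m and n the extra rows are three
-- arrangements of 1, …, m with constant column sum. Constant column sums are
-- enough because G is regular.
module Submission where

open import Data.Fin.Base using (Fin; zero; suc; toℕ; cast; combine; opposite; punchOut; _↑ˡ_; _↑ʳ_)
open import Data.Fin.Permutation using (cast-id; reverse)
open import Data.Fin.Properties using (_≟_; any?; injective⇒≤; punchOut-injective; remQuot-combine; combine-injective; toℕ-combine; toℕ-cast; toℕ<n; toℕ-↑ˡ; toℕ-↑ʳ; opposite-prop; +↔⊎; suc-injective)
open import Data.List.Base using (List; []; _∷_; _++_; map; filter; length; tabulate; allFin; cartesianProduct; cartesianProductWith)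
open import Data.List.Properties using (map-tabulate; tabulate-cong; map-++; map-∘; map-cong; filter-++; filter-all; filter-none)
open import Data.List.Relation.Unary.All using (universal)
open import Data.List.Relation.Unary.All.Properties using (map⁺)
open import Data.Nat.Base using (ℕ; zero; suc; _+_; _*_; _≥_; _>_; _/_; s≤s)
open import Data.Nat.DivMod using (_%_; m≡m%n+[m/n]*n; m%n<n; m*n%n≡0; [m+kn]%n≡m%n)
open import Data.Nat.ListAction using (sum)
open import Data.Nat.ListAction.Properties using (sum-++)
open import Data.Nat.Properties using (+-identityʳ; +-suc; *-comm; m∸n+n≡m; 1+n≰n)
open import Data.Nat.Tactic.RingSolver using (solve-∀)
open import Data.Product.Base using (∃-syntax; _×_; _,_; proj₁; proj₂)
open import Data.Sum.Base using (_⊎_; inj₁; inj₂)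
open import Data.Sum.Algebra using (⊎-comm)
open import Data.Vec.Functional using (Vector) renaming ([] to []ᵛ; _∷_ to _∷ᵛ_)
open import Function.Base using (id; _∘_)
open import Function.Bundles using (_↔_; _↣_; _⤖_; module Inverse; module Injection; module Bijection; mk↣; mk⤖)
open import Function.Consequences.Propositional using (strictlySurjective⇒surjective)
open import Function.Construct.Composition using (_↣-∘_)
open import Function.Construct.Symmetry using (↔-sym)
open import Function.Definitions using (Injective; StrictlySurjective)
open import Function.Properties.Inverse using (↔⇒↣)
open import Relation.Binary.PropositionalEquality using (_≡_; refl; sym; trans; cong; cong₂; module ≡-Reasoning)
open import Relation.Nullary.Decidable using (yes; no)
open import Relation.Nullary.Negation using (contradiction)
open import Relation.Unary using (Decidable)
open import Defs

open ≡-Reasoning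

private variable
  A B C : Set

-- Injections between finite sets of equal size

-- Pigeonhole: if `y` were missed, punching it out of the codomain would inject `Fin (suc n)` into
-- `Fin n`.
Fin-injective⇒surjective : ∀ {n} {f : Fin n → Fin n} →
  Injective _≡_ _≡_ f → StrictlySurjective _≡_ f
Fin-injective⇒surjective {suc n} {f} inj y with any? (λ x → f x ≟ y)
... | yes hit  = hit
... | no  miss = contradiction (injective⇒≤ avoid-injective) 1+n≰n
  where
  avoid-injective : Injective _≡_ _≡_ (λ x → punchOut {i = y} {f x} λ y≡fx → miss (x , sym y≡fx))
  avoid-injective {x} {z} = inj ∘ punchOut-injective {i = y} {f x} {f z} _ _

-- With this, a labelling need only be shown injective. Precomposing with the enumeration reduces
-- surjectivity to a self-map of `Fin n`.
↣⇒⤖ : ∀ {n} → A ↔ Fin n → A ↣ Fin n → A ⤖ Fin n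
↣⇒⤖ e f = mk⤖ (Injection.injective f , strictlySurjective⇒surjective surjective)
  where
  surjective : StrictlySurjective _≡_ (Injection.to f)
  surjective y =
    let x , fx≡y = Fin-injective⇒surjective (Injection.injective (f ↣-∘ ↔⇒↣ (↔-sym e))) y
    in Inverse.from e x , fx≡y

-- Sums over lists and over products of lists

sum-map-+ : ∀ (f g : A → ℕ) xs →
  sum (map (λ x → f x + g x) xs) ≡ sum (map f xs) + sum (map g xs)
sum-map-+ f g []       = refl
sum-map-+ f g (x ∷ xs) rewrite sum-map-+ f g xs =
  interchange (f x) (g x) (sum (map f xs)) (sum (map g xs))
  where
  interchange : ∀ a b c d → a + b + (c + d) ≡ a + c + (b + d)
  interchange = solve-∀

sum-map-const : ∀ c (xs : List A) → sum (map (λ _ → c) xs) ≡ length xs * c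
sum-map-const c []       = refl
sum-map-const c (x ∷ xs) = cong (c +_) (sum-map-const c xs)

sum-map-cartesianProduct : ∀ (f : A × B → ℕ) xs ys →
  sum (map f (cartesianProduct xs ys)) ≡ sum (map (λ x → sum (map (λ y → f (x , y)) ys)) xs)
sum-map-cartesianProduct f []       ys = refl
sum-map-cartesianProduct f (x ∷ xs) ys = begin
  sum (map f (map (x ,_) ys ++ cartesianProduct xs ys))
    ≡⟨ cong sum (map-++ f (map (x ,_) ys) _) ⟩
  sum (map f (map (x ,_) ys) ++ map f (cartesianProduct xs ys))
    ≡⟨ sum-++ (map f (map (x ,_) ys)) _ ⟩
  sum (map f (map (x ,_) ys)) + sum (map f (cartesianProduct xs ys))
    ≡⟨ cong₂ _+_ (cong sum (sym (map-∘ ys))) (sum-map-cartesianProduct f xs ys) ⟩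
  sum (map (λ y → f (x , y)) ys) + sum (map (λ x → sum (map (λ y → f (x , y)) ys)) xs) ∎

-- Neighbourhoods in G ∘ nK₁

tabulate-+ : ∀ m {n} (f : Fin (m + n) → A) →
  tabulate f ≡ tabulate (λ i → f (i ↑ˡ n)) ++ tabulate (λ j → f (m ↑ʳ j))
tabulate-+ zero    f = refl
tabulate-+ (suc m) f = cong (f zero ∷_) (tabulate-+ m (f ∘ suc))

-- `combine` and the cartesian product share the lexicographic order with the first coordinate
-- major, so induction on `m` splits off one block of length `n`.
tabulate-combine : ∀ {m n} {h : Fin (m * n) → C} (f : A → B → C) (a : Fin m → A) (b : Fin n → B) →
  (∀ i j → h (combine i j) ≡ f (a i) (b j)) →
  tabulate h ≡ cartesianProductWith f (tabulate a) (tabulate b)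
tabulate-combine {m = zero}          f a b eq = refl
tabulate-combine {m = suc m} {n} {h} f a b eq = trans (tabulate-+ n h) (cong₂ _++_
  (trans (tabulate-cong (eq zero)) (sym (map-tabulate b (f (a zero)))))
  (tabulate-combine f (a ∘ suc) b (eq ∘ suc)))

vertices-∘ₗ : ∀ {m n} (G : Graph m) (H : Graph n) →
  Graph.vertices (G ∘ₗ H) ≡ cartesianProduct (Graph.vertices G) (Graph.vertices H)
vertices-∘ₗ {m} {n} G H = begin
  map gh (allFin (m * n))                   ≡⟨ map-tabulate id gh ⟩
  tabulate gh                               ≡⟨ tabulate-combine _,_ g h gh-combine ⟩
  cartesianProduct (tabulate g) (tabulate h) ≡⟨ cong₂ cartesianProduct (map-tabulate id g) (map-tabulate id h) ⟨
  cartesianProduct (Graph.vertices G) (Graph.vertices H) ∎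
  where
  g  = Inverse.from (Graph.enumeration G)
  h  = Inverse.from (Graph.enumeration H)
  gh = Inverse.from (Graph.enumeration (G ∘ₗ H))
  gh-combine : ∀ i j → gh (combine i j) ≡ (g i , h j)
  gh-combine i j = cong (λ { (i , j) → g i , h j }) (remQuot-combine i j)

-- Since `Q` depends on the first coordinate alone, each block of pairs over `x` is kept or dropped
-- as a whole.
filter-cartesianProduct : ∀ {P : A → Set} {Q : A × B → Set} (P? : Decidable P) (Q? : Decidable Q) →
  (∀ {x y} → P x → Q (x , y)) → (∀ {x y} → Q (x , y) → P x) →
  ∀ xs ys → filter Q? (cartesianProduct xs ys) ≡ cartesianProduct (filter P? xs) ys
filter-cartesianProduct P? Q? P⇒Q Q⇒P []       ys = refl
filter-cartesianProduct P? Q? P⇒Q Q⇒P (x ∷ xs) ys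
  with ih ← filter-cartesianProduct P? Q? P⇒Q Q⇒P xs ys
     | split ← filter-++ Q? (map (x ,_) ys) (cartesianProduct xs ys)
  with P? x
... | yes px = trans split (cong₂ _++_ (filter-all Q? (map⁺ (universal (λ _ → P⇒Q px) ys))) ih)
... | no ¬px = trans split (cong₂ _++_ (filter-none Q? (map⁺ (universal (λ _ → ¬px ∘ Q⇒P) ys))) ih)

neighbours-∘ₗ-K₁ : ∀ {m} n (G : Graph m) g h →
  Graph.neighbours (G ∘ₗ n K₁) (g , h) ≡ cartesianProduct (Graph.neighbours G g) (allFin n)
neighbours-∘ₗ-K₁ n G g h = begin
  filter adj?′ (Graph.vertices (G ∘ₗ n K₁))
    ≡⟨ cong (filter adj?′) (vertices-∘ₗ G (n K₁)) ⟩
  filter adj?′ (cartesianProduct (Graph.vertices G) (Graph.vertices (n K₁)))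
    ≡⟨ filter-cartesianProduct (Graph.adj? G g) adj?′ inj₁ (λ { (inj₁ a) → a ; (inj₂ ()) }) (Graph.vertices G) _ ⟩
  cartesianProduct (Graph.neighbours G g) (Graph.vertices (n K₁))
    ≡⟨ cong (cartesianProduct (Graph.neighbours G g)) (map-tabulate id id) ⟩
  cartesianProduct (Graph.neighbours G g) (allFin n) ∎
  where adj?′ = Graph.adj? (G ∘ₗ n K₁) (g , h)

-- Vertex weights with constant neighbourhood sums

Balanced : ∀ {m} (G : Graph m) → (Graph.V G → ℕ) → Set
Balanced G w = ∃[ k ] (∀ x → sum (map w (Graph.neighbours G x)) ≡ k)

module _ {m} {G : Graph m} where

  Balanced-cong : ∀ {w w′} → (∀ y → w y ≡ w′ y) → Balanced G w′ → Balanced G w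
  Balanced-cong w≗w′ (k , eq) = k , λ x → trans (cong sum (map-cong w≗w′ (Graph.neighbours G x))) (eq x)

  Balanced-+ : ∀ {w w′} → Balanced G w → Balanced G w′ → Balanced G (λ y → w y + w′ y)
  Balanced-+ (k , eq) (k′ , eq′) = k + k′ , λ x →
    trans (sum-map-+ _ _ (Graph.neighbours G x)) (cong₂ _+_ (eq x) (eq′ x))

  -- Regularity enters here: every neighbourhood has `r` entries.
  Balanced-const : ∀ {r} → Regular r G → ∀ c → Balanced G (λ _ → c)
  Balanced-const {r} reg c = r * c , λ x →
    trans (sum-map-const c (Graph.neighbours G x)) (cong (_* c) (reg x))

-- Labellings of the product assembled from rows

columnSum : ∀ {m n} → Vector (A ↣ Fin m) n → A → ℕ
columnSum ρ y = sum (tabulate (λ j → suc (toℕ (Injection.to (ρ j) y))))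

-- Taking the row index `j` as the major coordinate sends row `j` to the block of labels with offset
-- `m * j`. The cast is due to `combine` landing in `Fin (n * m)`.
stack : ∀ {m n} → Vector (A ↣ Fin m) n → (A × Fin n) ↣ Fin (m * n)
stack {A = A} {m} {n} ρ = ↔⇒↣ (cast-id (*-comm n m)) ↣-∘ mk↣ {to = to} injective
  where
  to : A × Fin n → Fin (n * m)
  to (y , j) = combine j (Injection.to (ρ j) y)
  injective : Injective _≡_ _≡_ to
  injective {y , j} {y′ , j′} eq with combine-injective j _ j′ _ eq
  ... | refl , eq′ = cong (_, j) (Injection.injective (ρ j) eq′)

-- The first summand collects the row offsets; it is the same for every `y`.
stack-column : ∀ {m n} (ρ : Vector (A ↣ Fin m) n) y →
  sum (map (λ j → suc (toℕ (Injection.to (stack ρ) (y , j)))) (allFin n)) ≡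
  sum (map (λ j → m * toℕ j) (allFin n)) + columnSum ρ y
stack-column {m = m} {n} ρ y = begin
  sum (map (λ j → suc (toℕ (Injection.to (stack ρ) (y , j)))) (allFin n))
    ≡⟨ cong sum (map-cong entry (allFin n)) ⟩
  sum (map (λ j → m * toℕ j + suc (toℕ (Injection.to (ρ j) y))) (allFin n))
    ≡⟨ sum-map-+ _ _ (allFin n) ⟩
  sum (map (λ j → m * toℕ j) (allFin n)) + sum (map (λ j → suc (toℕ (Injection.to (ρ j) y))) (allFin n))
    ≡⟨ cong (λ xs → sum (map (λ j → m * toℕ j) (allFin n)) + sum xs) (map-tabulate id (λ j → suc (toℕ (Injection.to (ρ j) y)))) ⟩
  sum (map (λ j → m * toℕ j) (allFin n)) + columnSum ρ y ∎
  where
  entry : ∀ j → suc (toℕ (Injection.to (stack ρ) (y , j))) ≡ m * toℕ j + suc (toℕ (Injection.to (ρ j) y))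
  entry j = begin
    suc (toℕ (cast _ (combine j (Injection.to (ρ j) y)))) ≡⟨ cong suc (toℕ-cast _ (combine j _)) ⟩
    suc (toℕ (combine j (Injection.to (ρ j) y)))          ≡⟨ cong suc (toℕ-combine j _) ⟩
    suc (m * toℕ j + toℕ (Injection.to (ρ j) y))          ≡⟨ +-suc (m * toℕ j) _ ⟨
    m * toℕ j + suc (toℕ (Injection.to (ρ j) y))          ∎

balancedColumns⇒distanceMagic : ∀ {m n r} {G : Graph m} → Regular r G →
  (ρ : Vector (Graph.V G ↣ Fin m) n) → Balanced G (columnSum ρ) → DistanceMagic (G ∘ₗ n K₁)
balancedColumns⇒distanceMagic {m} {n} {G = G} reg ρ bal =
  ↣⇒⤖ (Graph.enumeration (G ∘ₗ n K₁)) (stack ρ) , k , λ (g , h) → begin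
    sum (map label (Graph.neighbours (G ∘ₗ n K₁) (g , h)))
      ≡⟨ cong (sum ∘ map label) (neighbours-∘ₗ-K₁ n G g h) ⟩
    sum (map label (cartesianProduct (Graph.neighbours G g) (allFin n)))
      ≡⟨ sum-map-cartesianProduct label (Graph.neighbours G g) (allFin n) ⟩
    sum (map (λ y → sum (map (λ j → label (y , j)) (allFin n))) (Graph.neighbours G g))
      ≡⟨ proj₂ columns g ⟩
    k ∎
  where
  label : Graph.V G × Fin n → ℕ
  label z = suc (toℕ (Injection.to (stack ρ) z))
  columns : Balanced G (λ y → sum (map (λ j → label (y , j)) (allFin n)))
  columns = Balanced-cong {G = G} (stack-column ρ) (Balanced-+ {G = G} (Balanced-const {G = G} reg _) bal)
  k = proj₁ columns

-- A row followed by its reversal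

reversed : ∀ {m} → A ↣ Fin m → A ↣ Fin m
reversed π = ↔⇒↣ reverse ↣-∘ π

opposite-complement : ∀ {n} (i : Fin n) → toℕ (opposite i) + suc (toℕ i) ≡ n
opposite-complement i rewrite opposite-prop i = m∸n+n≡m (toℕ<n i)

alternating : ∀ {m} → A ↣ Fin m → ∀ q → Vector (A ↣ Fin m) (q * 2)
alternating π zero    = []ᵛ
alternating π (suc q) = π ∷ᵛ reversed π ∷ᵛ alternating π q

-- Each pair of rows puts labels `i + 1` and `m - i` in a column, contributing `suc m`.
columnSum-alternating : ∀ {m} (π : A ↣ Fin m) q y → columnSum (alternating π q) y ≡ q * suc m
columnSum-alternating π zero y = refl
columnSum-alternating {m = m} π (suc q) y rewrite columnSum-alternating π q y = begin
  suc i + (suc (toℕ (opposite (Injection.to π y))) + q * suc m)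
    ≡⟨ regroup i (toℕ (opposite (Injection.to π y))) (q * suc m) ⟩
  suc (toℕ (opposite (Injection.to π y)) + suc i) + q * suc m
    ≡⟨ cong (λ s → suc s + q * suc m) (opposite-complement (Injection.to π y)) ⟩
  suc m + q * suc m ∎
  where
  i = toℕ (Injection.to π y)
  regroup : ∀ a b c → suc a + (suc b + c) ≡ suc (b + suc a) + c
  regroup = solve-∀

-- Three arrangements of 2p+1 labels with constant column sum

-- With labels counted from 0, the rows are
--   a,  p + a,  2p − 2a            in column inj₁ a,
--   p + 1 + b,  b,  2p − 1 − 2b    in column inj₂ b.
module Odd (p : ℕ) where

  private
    m : ℕ
    m = suc (p * 2)

    Column : Set
    Column = Fin (suc p) ⊎ Fin p

    size : suc p + p ≡ m
    size = solve p
      where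
      solve : ∀ p → suc p + p ≡ suc (p * 2)
      solve = solve-∀

    size′ : p + suc p ≡ m
    size′ = trans (+-suc p p) size

  row₁ : Column ↣ Fin m
  row₁ = ↔⇒↣ (cast-id size) ↣-∘ ↔⇒↣ (↔-sym +↔⊎)

  row₂ : Column ↣ Fin m
  -- The swap places the `Fin p` block first, so the columns `inj₁ a` start at `p`.
  row₂ = ↔⇒↣ (cast-id size′) ↣-∘ (↔⇒↣ (↔-sym (+↔⊎ {p})) ↣-∘ ↔⇒↣ (⊎-comm _ _))

  private
    -- The columns `inj₁ a` receive the even numbers `2a` and the columns `inj₂ b` the odd numbers
    -- `2b + 1`. Splitting off zero lets the rest be pairs of quotient and remainder by 2, so that
    -- injectivity comes from that of `combine`.
    merge : Column → Fin m
    merge (inj₁ zero)    = zero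
    merge (inj₁ (suc a)) = suc (combine {n = 2} a (suc zero))
    merge (inj₂ b)       = suc (combine {n = 2} b zero)

    merge-injective : Injective _≡_ _≡_ merge
    merge-injective {inj₁ zero}    {inj₁ zero}    eq = refl
    merge-injective {inj₁ (suc a)} {inj₁ (suc c)} eq =
      cong (inj₁ ∘ suc) (proj₁ (combine-injective a _ c _ (suc-injective eq)))
    merge-injective {inj₁ (suc a)} {inj₂ d}       eq
      with () ← proj₂ (combine-injective a (suc zero) d zero (suc-injective eq))
    merge-injective {inj₂ b}       {inj₁ (suc c)} eq
      with () ← proj₂ (combine-injective b zero c (suc zero) (suc-injective eq))
    merge-injective {inj₂ b}       {inj₂ d}       eq =
      cong inj₂ (proj₁ (combine-injective b _ d _ (suc-injective eq)))

  interleave : Column ↣ Fin m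
  interleave = mk↣ merge-injective

  toℕ-merge-inj₁ : ∀ a → toℕ (merge (inj₁ a)) ≡ 2 * toℕ a
  toℕ-merge-inj₁ zero    = refl
  toℕ-merge-inj₁ (suc a) = trans (cong suc (toℕ-combine a (suc zero))) (solve (toℕ a))
    where
    solve : ∀ a → suc (2 * a + 1) ≡ 2 * suc a
    solve = solve-∀

  toℕ-merge-inj₂ : ∀ b → toℕ (merge (inj₂ b)) ≡ suc (2 * toℕ b)
  toℕ-merge-inj₂ b = cong suc (trans (toℕ-combine b zero) (+-identityʳ _))

  -- The sums of the first two rows run once through the consecutive values from `p` to `3p`, so the
  -- reversal of `interleave` can level them.
  row₁+row₂ : ∀ x → toℕ (Injection.to row₁ x) + toℕ (Injection.to row₂ x) ≡ p + toℕ (Injection.to interleave x)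
  row₁+row₂ (inj₁ a) = begin
    toℕ (cast size (a ↑ˡ p)) + toℕ (cast size′ (p ↑ʳ a))
      ≡⟨ cong₂ _+_ (trans (toℕ-cast size (a ↑ˡ p)) (toℕ-↑ˡ a p)) (trans (toℕ-cast size′ (p ↑ʳ a)) (toℕ-↑ʳ p a)) ⟩
    toℕ a + (p + toℕ a)      ≡⟨ solve (toℕ a) p ⟩
    p + 2 * toℕ a            ≡⟨ cong (p +_) (toℕ-merge-inj₁ a) ⟨
    p + toℕ (merge (inj₁ a)) ∎
    where
    solve : ∀ a p → a + (p + a) ≡ p + 2 * a
    solve = solve-∀
  row₁+row₂ (inj₂ b) = begin
    toℕ (cast size (suc p ↑ʳ b)) + toℕ (cast size′ (b ↑ˡ suc p))
      ≡⟨ cong₂ _+_ (trans (toℕ-cast size (suc p ↑ʳ b)) (toℕ-↑ʳ (suc p) b)) (trans (toℕ-cast size′ (b ↑ˡ suc p)) (toℕ-↑ˡ b (suc p))) ⟩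
    suc p + toℕ b + toℕ b    ≡⟨ solve (toℕ b) p ⟩
    p + suc (2 * toℕ b)      ≡⟨ cong (p +_) (toℕ-merge-inj₂ b) ⟨
    p + toℕ (merge (inj₂ b)) ∎
    where
    solve : ∀ b p → suc p + b + b ≡ p + suc (2 * b)
    solve = solve-∀

  columns : Fin m ↣ Column
  columns = ↔⇒↣ +↔⊎ ↣-∘ ↔⇒↣ (cast-id (sym size))

  threeRows : (A ↣ Fin m) → ∀ {n} → Vector (A ↣ Fin m) n → Vector (A ↣ Fin m) (3 + n)
  threeRows π ρ = (row₁ ↣-∘ π′) ∷ᵛ (row₂ ↣-∘ π′) ∷ᵛ reversed (interleave ↣-∘ π′) ∷ᵛ ρ
    where π′ = columns ↣-∘ π

  -- The first two rows add up to `p + w` and the third is `2p - w`, counted from 0. Counting from 1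
  -- adds 3, whence `3p + 3 = 2 + p + m`.
  columnSum-threeRows : ∀ (π : A ↣ Fin m) {n} (ρ : Vector (A ↣ Fin m) n) y →
    columnSum (threeRows π ρ) y ≡ 2 + p + m + columnSum ρ y
  columnSum-threeRows π ρ y = begin
    suc u + (suc v + (suc w′ + s)) ≡⟨ regroup u v w′ s ⟩
    3 + (u + v) + w′ + s           ≡⟨ cong (λ t → 3 + t + w′ + s) (row₁+row₂ x) ⟩
    3 + (p + w) + w′ + s           ≡⟨ regroup′ p w w′ s ⟩
    2 + p + (w′ + suc w) + s       ≡⟨ cong (λ t → 2 + p + t + s) (opposite-complement (merge x)) ⟩
    2 + p + m + s                  ∎
    where
    x  = Injection.to (columns ↣-∘ π) y
    u  = toℕ (Injection.to row₁ x)
    v  = toℕ (Injection.to row₂ x)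
    w  = toℕ (merge x)
    w′ = toℕ (opposite (merge x))
    s  = columnSum ρ y
    regroup : ∀ u v w s → suc u + (suc v + (suc w + s)) ≡ 3 + (u + v) + w + s
    regroup = solve-∀
    regroup′ : ∀ p w w′ s → 3 + (p + w) + w′ + s ≡ 2 + p + (w′ + suc w) + s
    regroup′ = solve-∀

-- Parity and the three cases

parity : ∀ n → (∃[ q ] n ≡ q * 2) ⊎ (∃[ q ] n ≡ suc (q * 2))
parity n with n % 2 | m%n<n n 2 | m≡m%n+[m/n]*n n 2
... | 0 | _ | eq = inj₁ (n / 2 , eq)
... | 1 | _ | eq = inj₂ (n / 2 , eq)
... | suc (suc _) | s≤s (s≤s ()) | _

even*-%2 : ∀ p n → (p * 2 * n) % 2 ≡ 0
even*-%2 p n = trans (cong (_% 2) (regroup p n)) (m*n%n≡0 (p * n) 2)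
  where
  regroup : ∀ p n → p * 2 * n ≡ p * n * 2
  regroup = solve-∀

module _ {m r} {G : Graph m} (reg : Regular r G) where

  distanceMagic-even : ∀ q → DistanceMagic (G ∘ₗ (q * 2) K₁)
  distanceMagic-even q = balancedColumns⇒distanceMagic {G = G} reg (alternating π q)
    (Balanced-cong {G = G} (columnSum-alternating π q) (Balanced-const {G = G} reg _))
    where π = ↔⇒↣ (Graph.enumeration G)

  distanceMagic-odd : DistanceMagic G → ∀ q → DistanceMagic (G ∘ₗ (suc (q * 2)) K₁)
  distanceMagic-odd (f , bal) q = balancedColumns⇒distanceMagic {G = G} reg (π ∷ᵛ alternating π q)
    -- The column sum unfolds to the given magic label plus the sum of the alternating rows, so
    -- `bal` applies to the first term as it stands.
    (Balanced-+ {G = G} bal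
      (Balanced-cong {G = G} (columnSum-alternating π q) (Balanced-const {G = G} reg _)))
    where π = Bijection.injection f

distanceMagic-odd-odd : ∀ p {r} {G : Graph (suc (p * 2))} → Regular r G →
  ∀ q → DistanceMagic (G ∘ₗ (3 + q * 2) K₁)
distanceMagic-odd-odd p {G = G} reg q =
  balancedColumns⇒distanceMagic {G = G} reg (threeRows π (alternating π q))
    (Balanced-cong {G = G} (λ y → trans (columnSum-threeRows π (alternating π q) y)
                                        (cong (2 + p + suc (p * 2) +_) (columnSum-alternating π q y)))
      (Balanced-const {G = G} reg _))
  where
  open Odd p
  π = ↔⇒↣ (Graph.enumeration G)

theorem14 : (m n r : ℕ) → m ≥ 1 → n > 1 → (G : Graph m) → Regular r G →
    (n % 2 ≡ 0) ⊎ (m * n) % 2 ≡ 1 ⊎ DistanceMagic G →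
    DistanceMagic (G ∘ₗ n K₁)
theorem14 m n r _ n>1 G reg hyp with parity n | hyp
... | inj₁ (q , refl) | _ = distanceMagic-even {G = G} reg q
... | inj₂ (q , refl) | inj₁ n-even with () ← trans (sym n-even) ([m+kn]%n≡m%n 1 q 2)
... | inj₂ (q , refl) | inj₂ (inj₂ magic) = distanceMagic-odd {G = G} reg magic q
-- Here `n` would be 1, too few for three rows.
... | inj₂ (zero , refl) | inj₂ (inj₁ _) = contradiction n>1 1+n≰n
-- Now `n` is `3 + q * 2`: three special rows and `q` reversed pairs. An even `m` would make `m * n`
-- even.
... | inj₂ (suc q , refl) | inj₂ (inj₁ mn-odd) with parity m
...   | inj₁ (p , refl) with () ← trans (sym mn-odd) (even*-%2 p n)
...   | inj₂ (p , refl) = distanceMagic-odd-odd p {G = G} reg q
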